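{- Let $\mathcal M$ be a monoidal category, let $\mathcal B,\mathcal C,\mathcal E$ be $\mathcal M$-actegories and let $\Gamma:\mathcal C\to\mathcal B$ be a lax $\mathcal M$-equivariant functor. Let $p:\mathcal E\to\mathcal B$ be a strict $\mathcal M$-equivariant functor which is also an opfibration, and suppose that for every object $m$ of $\mathcal M$ the functor $m\cdot(-):\mathcal E\to\mathcal E$ preserves opcartesian morphisms. Let $\mathcal G$ be the pullback in $\mathbf{Cat}$ of $p$ along $\Gamma$, with projection $q:\mathcal G\to\mathcal C$. Then $\mathcal G$ has an $\mathcal M$-action such that $q:\mathcal G\to\mathcal C$ is strict $\mathcal M$-equivariant.
   Context: Let $(\mathcal M,\otimes,I)$ be a monoidal category. An $\mathcal M$-action on a category $\mathcal C$ is a bifunctor $(-)\cdot(-):\mathcal M\times\mathcal C\to\mathcal C$ with natural isomorphisms $\eta_c:I\cdot c\to c$ and $\mu_{m_1,m_2,c}:(m_1\otimes m_2)\cdot c\to m_1\cdot(m_2\cdot c)$ such that (suppressing associators) $\mu_{m_1,m_2,m_3\cdot c}\circ\mu_{m_1\otimes m_2,m_3,c}=(\mathrm{id}\cdot\mu_{m_2,m_3,c})\circ\mu_{m_1,m_2\otimes m_3,c}$ and $(\mathrm{id}_m\cdot\eta_c)\circ\mu_{m,I,c}=r_m\cdot\mathrm{id}_c$, with $r_m:m\otimes I\to m$ the right unitor. An $\mathcal M$-actegory is a category with an $\mathcal M$-action. A functor $F:\mathcal C\to\mathcal D$ between $\mathcal M$-actegories is lax $\mathcal M$-equivariant if it is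 equipped with a natural transformation $\phi_{m,c}:m\cdot Fc\to F(m\cdot c)$ such that $F\mu_{m,m',c}\circ\phi_{m\otimes m',c}=\phi_{m,m'\cdot c}\circ(\mathrm{id}\cdot\phi_{m',c})\circ\mu_{m,m',Fc}$ and $F\eta_c\circ\phi_{I,c}=\eta_{Fc}$. It is strong if $\phi$ is an isomorphism and strict if $\phi$ is the identity. The pullback $\mathcal G$ has as objects pairs $(C,X)\in\mathcal C\times\mathcal E$ with $\Gamma C=pX$, and as morphisms pairs $(f,x)$ with $\Gamma f=px$; $q(C,X)=C$. -}

module Defs where

open import Level using (Level; _⊔_; suc)
open import Data.Product using (Σ; Σ-syntax; _×_; _,_; proj₁; proj₂)
open import Relation.Binary.Core using (Rel)
open import Relation.Binary.Structures using (IsEquivalence)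
open import Relation.Binary.PropositionalEquality using (_≡_)

-- Hom-sets are setoids. Equality of objects is propositional equality, which is
-- proof irrelevant here: nothing in this development disables axiom K.
record Category (o ℓ e : Level) : Set (suc (o ⊔ ℓ ⊔ e)) where
  infix  4 _≈_ _⇒_ _≋_
  infixr 9 _∘_
  field
    Obj : Set o
    _⇒_ : Obj → Obj → Set ℓ
    _≈_ : ∀ {A B} → Rel (A ⇒ B) e
    id  : ∀ {A} → A ⇒ A
    _∘_ : ∀ {A B C} → B ⇒ C → A ⇒ B → A ⇒ C

    assoc     : ∀ {A B C D} {f : A ⇒ B} {g : B ⇒ C} {h : C ⇒ D} →
                (h ∘ g) ∘ f ≈ h ∘ (g ∘ f)
    identityˡ : ∀ {A B} {f : A ⇒ B} → id ∘ f ≈ f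
    identityʳ : ∀ {A B} {f : A ⇒ B} → f ∘ id ≈ f
    equiv     : ∀ {A B} → IsEquivalence (_≈_ {A} {B})
    ∘-resp-≈  : ∀ {A B C} {f h : B ⇒ C} {g i : A ⇒ B} →
                f ≈ h → g ≈ i → f ∘ g ≈ h ∘ i

  module Equiv {A B : Obj} = IsEquivalence (equiv {A} {B})

  -- Equality of arrows whose endpoints are not definitionally the same:
  -- f ≋ g holds when the domains are equal, the codomains are equal, and
  -- f ≈ g after identifying them.
  data _≋_ {A B : Obj} (f : A ⇒ B) : {A′ B′ : Obj} → A′ ⇒ B′ → Set (ℓ ⊔ e) where
    ≈⇒≋ : {g : A ⇒ B} → f ≈ g → f ≋ g

  ≋-sym : ∀ {A B A′ B′} {f : A ⇒ B} {g : A′ ⇒ B′} → f ≋ g → g ≋ f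
  ≋-sym (≈⇒≋ p) = ≈⇒≋ (Equiv.sym p)

  ≋-trans : ∀ {A B A′ B′ A″ B″} {f : A ⇒ B} {g : A′ ⇒ B′} {h : A″ ⇒ B″} →
            f ≋ g → g ≋ h → f ≋ h
  ≋-trans (≈⇒≋ p) (≈⇒≋ q) = ≈⇒≋ (Equiv.trans p q)

  ∘-resp-≋ : ∀ {A B C A′ B′ C′} {g : B ⇒ C} {f : A ⇒ B} {g′ : B′ ⇒ C′} {f′ : A′ ⇒ B′} →
             g ≋ g′ → f ≋ f′ → g ∘ f ≋ g′ ∘ f′
  ∘-resp-≋ (≈⇒≋ p) (≈⇒≋ q) = ≈⇒≋ (∘-resp-≈ p q)

  id-≋ : ∀ {A A′} → A ≡ A′ → id {A} ≋ id {A′}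
  id-≋ _≡_.refl = ≈⇒≋ Equiv.refl

  record IsIso {A B : Obj} (f : A ⇒ B) : Set (ℓ ⊔ e) where
    field
      inv  : B ⇒ A
      isoˡ : inv ∘ f ≈ id
      isoʳ : f ∘ inv ≈ id

record Functor {o ℓ e o′ ℓ′ e′ : Level}
               (C : Category o ℓ e) (D : Category o′ ℓ′ e′) :
               Set (o ⊔ ℓ ⊔ e ⊔ o′ ⊔ ℓ′ ⊔ e′) where
  private
    module C = Category C
    module D = Category D
  field
    F₀ : C.Obj → D.Obj
    F₁ : ∀ {A B} → A C.⇒ B → F₀ A D.⇒ F₀ B

    identity     : ∀ {A} → F₁ (C.id {A}) D.≈ D.id
    homomorphism : ∀ {X Y Z} {f : X C.⇒ Y} {g : Y C.⇒ Z} →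
                   F₁ (g C.∘ f) D.≈ F₁ g D.∘ F₁ f
    F-resp-≈     : ∀ {A B} {f g : A C.⇒ B} → f C.≈ g → F₁ f D.≈ F₁ g

infixr 2 _⊠_

_⊠_ : ∀ {o ℓ e o′ ℓ′ e′} → Category o ℓ e → Category o′ ℓ′ e′ →
      Category (o ⊔ o′) (ℓ ⊔ ℓ′) (e ⊔ e′)
C ⊠ D = record
  { Obj       = C.Obj × D.Obj
  ; _⇒_       = λ (A , X) (B , Y) → (A C.⇒ B) × (X D.⇒ Y)
  ; _≈_       = λ (f , x) (g , y) → (f C.≈ g) × (x D.≈ y)
  ; id        = C.id , D.id
  ; _∘_       = λ (g , y) (f , x) → (g C.∘ f) , (y D.∘ x)
  ; assoc     = C.assoc , D.assoc
  ; identityˡ = C.identityˡ , D.identityˡ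
  ; identityʳ = C.identityʳ , D.identityʳ
  ; equiv     = record
    { refl  = C.Equiv.refl , D.Equiv.refl
    ; sym   = λ (p , q) → C.Equiv.sym p , D.Equiv.sym q
    ; trans = λ (p , q) (p′ , q′) → C.Equiv.trans p p′ , D.Equiv.trans q q′
    }
  ; ∘-resp-≈  = λ (p , q) (p′ , q′) → C.∘-resp-≈ p p′ , D.∘-resp-≈ q q′
  }
  where
    module C = Category C
    module D = Category D

record MonoidalCategory (o ℓ e : Level) : Set (suc (o ⊔ ℓ ⊔ e)) where
  field
    category : Category o ℓ e
  open Category category public

  field
    ⊗ : Functor (category ⊠ category) category
    I : Obj

  infixr 10 _⊗₀_ _⊗₁_

  _⊗₀_ : Obj → Obj → Obj
  m ⊗₀ n = Functor.F₀ ⊗ (m , n)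

  _⊗₁_ : ∀ {m m′ n n′} → m ⇒ m′ → n ⇒ n′ → m ⊗₀ n ⇒ m′ ⊗₀ n′
  u ⊗₁ v = Functor.F₁ ⊗ (u , v)

  field
    l : ∀ m → I ⊗₀ m ⇒ m
    r : ∀ m → m ⊗₀ I ⇒ m
    α : ∀ m₁ m₂ m₃ → (m₁ ⊗₀ m₂) ⊗₀ m₃ ⇒ m₁ ⊗₀ (m₂ ⊗₀ m₃)

    l-natural : ∀ {m n} (u : m ⇒ n) → l n ∘ (id ⊗₁ u) ≈ u ∘ l m
    r-natural : ∀ {m n} (u : m ⇒ n) → r n ∘ (u ⊗₁ id) ≈ u ∘ r m
    α-natural : ∀ {m₁ m₂ m₃ n₁ n₂ n₃} (u : m₁ ⇒ n₁) (v : m₂ ⇒ n₂) (w : m₃ ⇒ n₃) →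
                α n₁ n₂ n₃ ∘ ((u ⊗₁ v) ⊗₁ w) ≈ (u ⊗₁ (v ⊗₁ w)) ∘ α m₁ m₂ m₃

    l-iso : ∀ m → IsIso (l m)
    r-iso : ∀ m → IsIso (r m)
    α-iso : ∀ m₁ m₂ m₃ → IsIso (α m₁ m₂ m₃)

    triangle : ∀ m n → (id ⊗₁ l n) ∘ α m I n ≈ r m ⊗₁ id
    pentagon : ∀ m₁ m₂ m₃ m₄ →
               α m₁ m₂ (m₃ ⊗₀ m₄) ∘ α (m₁ ⊗₀ m₂) m₃ m₄
               ≈ (id ⊗₁ α m₂ m₃ m₄) ∘ (α m₁ (m₂ ⊗₀ m₃) m₄ ∘ (α m₁ m₂ m₃ ⊗₁ id))

record Action {oM ℓM eM o ℓ e : Level}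
              (M : MonoidalCategory oM ℓM eM) (C : Category o ℓ e) :
              Set (oM ⊔ ℓM ⊔ eM ⊔ o ⊔ ℓ ⊔ e) where
  private
    module M = MonoidalCategory M
  open Category C
  open MonoidalCategory M using (I; _⊗₀_; _⊗₁_)

  field
    act : Functor (M.category ⊠ C) C

  infixr 10 _·₀_ _·₁_

  _·₀_ : M.Obj → Obj → Obj
  m ·₀ c = Functor.F₀ act (m , c)

  _·₁_ : ∀ {m n c d} → m M.⇒ n → c ⇒ d → m ·₀ c ⇒ n ·₀ d
  u ·₁ f = Functor.F₁ act (u , f)

  field
    η : ∀ c → I ·₀ c ⇒ c
    μ : ∀ m₁ m₂ c → (m₁ ⊗₀ m₂) ·₀ c ⇒ m₁ ·₀ (m₂ ·₀ c)

    η-natural : ∀ {c d} (f : c ⇒ d) → η d ∘ (M.id ·₁ f) ≈ f ∘ η c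
    μ-natural : ∀ {m₁ m₂ n₁ n₂ c d} (u : m₁ M.⇒ n₁) (v : m₂ M.⇒ n₂) (f : c ⇒ d) →
                μ n₁ n₂ d ∘ ((u ⊗₁ v) ·₁ f) ≈ (u ·₁ (v ·₁ f)) ∘ μ m₁ m₂ c

    η-iso : ∀ c → IsIso (η c)
    μ-iso : ∀ m₁ m₂ c → IsIso (μ m₁ m₂ c)

    μ-assoc : ∀ m₁ m₂ m₃ c →
              μ m₁ m₂ (m₃ ·₀ c) ∘ μ (m₁ ⊗₀ m₂) m₃ c
              ≈ (M.id ·₁ μ m₂ m₃ c) ∘ (μ m₁ (m₂ ⊗₀ m₃) c ∘ (M.α m₁ m₂ m₃ ·₁ id))
    μ-unit  : ∀ m c → (M.id ·₁ η c) ∘ μ m I c ≈ M.r m ·₁ id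

record Actegory {oM ℓM eM : Level} (M : MonoidalCategory oM ℓM eM) (o ℓ e : Level) :
                Set (oM ⊔ ℓM ⊔ eM ⊔ suc (o ⊔ ℓ ⊔ e)) where
  constructor actegory
  field
    category : Category o ℓ e
    action   : Action M category
  open Category category public
  open Action action public

module _ {oM ℓM eM o ℓ e o′ ℓ′ e′ : Level} {M : MonoidalCategory oM ℓM eM}
         (C : Actegory M o ℓ e) (D : Actegory M o′ ℓ′ e′) where
  private
    module M = MonoidalCategory M
    module C = Actegory C
    module D = Actegory D
  open MonoidalCategory M using (I; _⊗₀_)
  open Actegory D using (_∘_; _≈_)

  record LaxEquivariant (F : Functor C.category D.category) :
                        Set (oM ⊔ ℓM ⊔ eM ⊔ o ⊔ ℓ ⊔ e ⊔ o′ ⊔ ℓ′ ⊔ e′) where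
    open Functor F using (F₀; F₁)
    field
      φ : ∀ m c → (m D.·₀ F₀ c) D.⇒ F₀ (m C.·₀ c)

      φ-natural : ∀ {m n c d} (u : m M.⇒ n) (f : c C.⇒ d) →
                  φ n d ∘ (u D.·₁ F₁ f) ≈ F₁ (u C.·₁ f) ∘ φ m c
      φ-μ : ∀ m m′ c →
            F₁ (C.μ m m′ c) ∘ φ (m ⊗₀ m′) c
            ≈ φ m (m′ C.·₀ c) ∘ ((M.id D.·₁ φ m′ c) ∘ D.μ m m′ (F₀ c))
      φ-η : ∀ c → F₁ (C.η c) ∘ φ I c ≈ D.η (F₀ c)

  -- φ-identity contains the equality of objects m · F c ≡ F (m · c).
  record StrictEquivariant (F : Functor C.category D.category) :
                           Set (oM ⊔ ℓM ⊔ eM ⊔ o ⊔ ℓ ⊔ e ⊔ o′ ⊔ ℓ′ ⊔ e′) where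
    field
      laxEquivariant : LaxEquivariant F
    open LaxEquivariant laxEquivariant public
    field
      φ-identity : ∀ m c → φ m c D.≋ D.id {m D.·₀ Functor.F₀ F c}

module _ {o ℓ e o′ ℓ′ e′ : Level} {E : Category o ℓ e} {B : Category o′ ℓ′ e′}
         (p : Functor E B) where
  private
    module E = Category E
    module B = Category B
  open Functor p using () renaming (F₀ to p₀; F₁ to p₁)

  record IsOpcartesian {X Y : E.Obj} (x : X E.⇒ Y) : Set (o ⊔ ℓ ⊔ e ⊔ ℓ′ ⊔ e′) where
    field
      factor   : ∀ {Z} (z : X E.⇒ Z) (g : p₀ Y B.⇒ p₀ Z) → g B.∘ p₁ x B.≈ p₁ z → Y E.⇒ Z
      over     : ∀ {Z} (z : X E.⇒ Z) (g : p₀ Y B.⇒ p₀ Z) (h : g B.∘ p₁ x B.≈ p₁ z) →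
                 p₁ (factor z g h) B.≈ g
      commutes : ∀ {Z} (z : X E.⇒ Z) (g : p₀ Y B.⇒ p₀ Z) (h : g B.∘ p₁ x B.≈ p₁ z) →
                 factor z g h E.∘ x E.≈ z
      unique   : ∀ {Z} (z : X E.⇒ Z) (g : p₀ Y B.⇒ p₀ Z) (h : g B.∘ p₁ x B.≈ p₁ z) →
                 (y : Y E.⇒ Z) → p₁ y B.≈ g → y E.∘ x E.≈ z → y E.≈ factor z g h

  -- p₁ x ≋ f contains the equality p₀ Y ≡ b, so x really is a lift of f.
  IsOpfibration : Set (o ⊔ ℓ ⊔ e ⊔ o′ ⊔ ℓ′ ⊔ e′)
  IsOpfibration = ∀ (X : E.Obj) {b : B.Obj} (f : p₀ X B.⇒ b) →
    Σ[ Y ∈ E.Obj ] Σ[ x ∈ X E.⇒ Y ] (p₁ x B.≋ f) × IsOpcartesian x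

module _ {o₁ ℓ₁ e₁ o₂ ℓ₂ e₂ o₃ ℓ₃ e₃ : Level}
         {C : Category o₁ ℓ₁ e₁} {E : Category o₂ ℓ₂ e₂} {B : Category o₃ ℓ₃ e₃}
         (Γ : Functor C B) (p : Functor E B) where
  private
    module C = Category C
    module E = Category E
    module B = Category B
    module Γ = Functor Γ
    module p = Functor p

  record PullbackObj : Set (o₁ ⊔ o₂ ⊔ o₃) where
    constructor obj
    field
      base  : C.Obj
      total : E.Obj
      agree : Γ.F₀ base ≡ p.F₀ total
  open PullbackObj

  record PullbackHom (P Q : PullbackObj) : Set (ℓ₁ ⊔ ℓ₂ ⊔ ℓ₃ ⊔ e₃) where
    constructor hom
    field
      base₁  : base P C.⇒ base Q
      total₁ : total P E.⇒ total Q
      agree₁ : Γ.F₁ base₁ B.≋ p.F₁ total₁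
  open PullbackHom

  Pullback : Category (o₁ ⊔ o₂ ⊔ o₃) (ℓ₁ ⊔ ℓ₂ ⊔ ℓ₃ ⊔ e₃) (e₁ ⊔ e₂)
  Pullback = record
    { Obj       = PullbackObj
    ; _⇒_       = PullbackHom
    ; _≈_       = λ k k′ → (base₁ k C.≈ base₁ k′) × (total₁ k E.≈ total₁ k′)
    ; id        = λ {P} → hom C.id E.id
        (B.≋-trans (B.≈⇒≋ Γ.identity)
          (B.≋-trans (B.id-≋ (agree P)) (B.≋-sym (B.≈⇒≋ p.identity))))
    ; _∘_       = λ k k′ → hom (base₁ k C.∘ base₁ k′) (total₁ k E.∘ total₁ k′)
        (B.≋-trans (B.≈⇒≋ Γ.homomorphism)
          (B.≋-trans (B.∘-resp-≋ (agree₁ k) (agree₁ k′)) (B.≋-sym (B.≈⇒≋ p.homomorphism))))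
    ; assoc     = C.assoc , E.assoc
    ; identityˡ = C.identityˡ , E.identityˡ
    ; identityʳ = C.identityʳ , E.identityʳ
    ; equiv     = record
      { refl  = C.Equiv.refl , E.Equiv.refl
      ; sym   = λ (s , t) → C.Equiv.sym s , E.Equiv.sym t
      ; trans = λ (s , t) (s′ , t′) → C.Equiv.trans s s′ , E.Equiv.trans t t′
      }
    ; ∘-resp-≈  = λ (s , t) (s′ , t′) → C.∘-resp-≈ s s′ , E.∘-resp-≈ t t′
    }

  pullbackProj : Functor Pullback C
  pullbackProj = record
    { F₀           = base
    ; F₁           = base₁
    ; identity     = C.Equiv.refl
    ; homomorphism = C.Equiv.refl
    ; F-resp-≈     = proj₁
    }

module _ {oM ℓM eM o ℓ e : Level} {M : MonoidalCategory oM ℓM eM} (C : Actegory M o ℓ e) where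
  private
    module M = MonoidalCategory M
    module C = Actegory C

  actOn : M.Obj → Functor C.category C.category
  actOn m = record
    { F₀           = λ c → m C.·₀ c
    ; F₁           = λ f → M.id C.·₁ f
    ; identity     = act.identity
    ; homomorphism = C.Equiv.trans
        (act.F-resp-≈ (M.Equiv.sym M.identityˡ , C.Equiv.refl)) act.homomorphism
    ; F-resp-≈     = λ h → act.F-resp-≈ (M.Equiv.refl , h)
    }
    where module act = Functor C.act

PreservesOpcartesian : ∀ {o ℓ e o′ ℓ′ e′} {E : Category o ℓ e} {B : Category o′ ℓ′ e′} →
                       Functor E B → Functor E E → Set (o ⊔ ℓ ⊔ e ⊔ ℓ′ ⊔ e′)
PreservesOpcartesian {E = E} p T =
  ∀ {X Y : Obj} (x : X ⇒ Y) → IsOpcartesian p x → IsOpcartesian p (Functor.F₁ T x)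
  where open Category E

{-# OPTIONS --safe #-}
-- The object m · (C , X) is (m · C , Y), where m · X → Y is an opcartesian lift
-- of φ m C : m · Γ C → Γ (m · C); this makes sense because
-- p (m · X) = m · p X = m · Γ C. All structure maps of the new action are induced by the
-- universal property of these lifts, and all equations hold by uniqueness. The
-- map μ compares the lift (m ⊗ n) · X → Y with the composite of μ for E, the image
-- under m · (-) of the lift for n, and the lift for m. That composite is opcartesian
-- by the preservation hypothesis, and an arrow comparing two opcartesian arrows over
-- an isomorphism is an isomorphism.
module Submission where

open import Level using (Level)
open import Data.Product using (Σ-syntax; _×_; _,_; proj₁; proj₂)
open import Relation.Binary.Bundles using (Setoid)
open import Relation.Binary.PropositionalEquality using (_≡_; refl; sym; trans; cong)
import Relation.Binary.Reasoning.Setoid as SetoidReasoning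
open import Defs

-- Rewriting of composites, and equality of arrows across equal endpoints.

module CategoryProperties {o ℓ e : Level} (C : Category o ℓ e) where
  open Category C

  hom-setoid : Obj → Obj → Setoid ℓ e
  hom-setoid X Y = record { Carrier = X ⇒ Y ; _≈_ = _≈_ ; isEquivalence = equiv }

  module ≈-Reasoning {X Y : Obj} = SetoidReasoning (hom-setoid X Y)

  private
    variable
      X Y Z W X′ Y′ : Obj

  infixr 4 refl⟩∘⟨_
  infixl 5 _⟩∘⟨refl

  refl⟩∘⟨_ : {f : Y ⇒ Z} {g h : X ⇒ Y} → g ≈ h → f ∘ g ≈ f ∘ h
  refl⟩∘⟨ p = ∘-resp-≈ Equiv.refl p

  _⟩∘⟨refl : {f g : Y ⇒ Z} {h : X ⇒ Y} → f ≈ g → f ∘ h ≈ g ∘ h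
  p ⟩∘⟨refl = ∘-resp-≈ p Equiv.refl

  sym-assoc : {f : X ⇒ Y} {g : Y ⇒ Z} {h : Z ⇒ W} → h ∘ (g ∘ f) ≈ (h ∘ g) ∘ f
  sym-assoc = Equiv.sym assoc

  pullˡ : {f : Y ⇒ Z} {g : X ⇒ Y} {h : X ⇒ Z} {k : W ⇒ X} →
          f ∘ g ≈ h → f ∘ (g ∘ k) ≈ h ∘ k
  pullˡ p = Equiv.trans sym-assoc (p ⟩∘⟨refl)

  pullʳ : {f : Y ⇒ Z} {g : X ⇒ Y} {h : W ⇒ X} {k : W ⇒ Y} →
          g ∘ h ≈ k → (f ∘ g) ∘ h ≈ f ∘ k
  pullʳ p = Equiv.trans assoc (refl⟩∘⟨ p)

  cancelˡ : {f : Y ⇒ X} {g : X ⇒ Y} {h : Z ⇒ X} → f ∘ g ≈ id → f ∘ (g ∘ h) ≈ h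
  cancelˡ p = Equiv.trans (pullˡ p) identityˡ

  cancelʳ : {f : Y ⇒ X} {g : X ⇒ Y} {h : X ⇒ Z} → f ∘ g ≈ id → (h ∘ f) ∘ g ≈ h
  cancelʳ p = Equiv.trans (pullʳ p) identityʳ

  -- The object equalities hidden in `≋` are loops here, and axiom K makes them trivial.
  ≋⇒≈ : {f g : X ⇒ Y} → f ≋ g → f ≈ g
  ≋⇒≈ (≈⇒≋ p) = p

  ≋-refl : {f : X ⇒ Y} → f ≋ f
  ≋-refl = ≈⇒≋ Equiv.refl

  ≋-cod : {f : X ⇒ Y} {g : X′ ⇒ Y′} → f ≋ g → Y ≡ Y′
  ≋-cod (≈⇒≋ _) = refl

  -- With `≋-∘-id`, this deletes the components of `φ` of a strict functor, which are identities
  -- only after their endpoints are identified.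
  ≋-id-∘ : {f : X ⇒ X′} {g : Y ⇒ X} → f ≋ id {X} → f ∘ g ≋ g
  ≋-id-∘ (≈⇒≋ p) = ≈⇒≋ (Equiv.trans (p ⟩∘⟨refl) identityˡ)

  ≋-∘-id : {f : X ⇒ X′} {g : X′ ⇒ Y} → f ≋ id {X} → g ∘ f ≋ g
  ≋-∘-id (≈⇒≋ p) = ≈⇒≋ (Equiv.trans (refl⟩∘⟨ p) identityʳ)

-- Opcartesian arrows.

module _ {o ℓ e o′ ℓ′ e′ : Level} {E : Category o ℓ e} {B : Category o′ ℓ′ e′}
         (p : Functor E B) where
  private
    module E where
      open Category E public
      open CategoryProperties E public
    module B where
      open Category B public
      open CategoryProperties B public
    module p = Functor p

  -- The only possible filler is `z ∘ inv`; it lies over `g` because `p` preserves inverses.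
  iso⇒opcartesian : ∀ {X Y} {x : X E.⇒ Y} → E.IsIso x → IsOpcartesian p x
  iso⇒opcartesian {x = x} x-iso = record
    { factor   = λ z g h → z E.∘ inv
    ; over     = λ z g h → begin
        p.F₁ (z E.∘ inv)                   ≈⟨ p.homomorphism ⟩
        p.F₁ z B.∘ p.F₁ inv                ≈⟨ h B.⟩∘⟨refl ⟨
        (g B.∘ p.F₁ x) B.∘ p.F₁ inv        ≈⟨ B.cancelʳ p-isoʳ ⟩
        g                                  ∎
    ; commutes = λ z g h → E.cancelʳ isoˡ
    ; unique   = λ z g h y _ y∘x≈z →
        E.Equiv.trans (E.Equiv.sym (E.cancelʳ isoʳ)) (y∘x≈z E.⟩∘⟨refl)
    }
    where
    open E.IsIso x-iso
    open B.≈-Reasoning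
    p-isoʳ : p.F₁ x B.∘ p.F₁ inv B.≈ B.id
    p-isoʳ = B.Equiv.trans (B.Equiv.sym p.homomorphism)
               (B.Equiv.trans (p.F-resp-≈ isoʳ) p.identity)

  -- Factor twice: first through `x` over `g ∘ p y`, then through `y` over `g`.
  opcartesian-∘ : ∀ {X Y Z} {y : Y E.⇒ Z} {x : X E.⇒ Y} →
                  IsOpcartesian p y → IsOpcartesian p x → IsOpcartesian p (y E.∘ x)
  opcartesian-∘ {y = y} {x} y-opc x-opc = record
    { factor   = λ z g h → y.factor (inner z g h) g (inner-over z g h)
    ; over     = λ z g h → y.over (inner z g h) g (inner-over z g h)
    ; commutes = λ z g h → E.Equiv.trans
        (E.pullˡ (y.commutes (inner z g h) g (inner-over z g h)))
        (x.commutes z (g B.∘ p.F₁ y) (split h))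
    ; unique   = λ z g h w pw≈g w∘yx≈z →
        y.unique (inner z g h) g (inner-over z g h) w pw≈g
          (x.unique z (g B.∘ p.F₁ y) (split h) (w E.∘ y)
            (B.Equiv.trans p.homomorphism (pw≈g B.⟩∘⟨refl))
            (E.Equiv.trans E.assoc w∘yx≈z))
    }
    where
    module x = IsOpcartesian x-opc
    module y = IsOpcartesian y-opc
    split : ∀ {W} {z : _ E.⇒ W} {g} → g B.∘ p.F₁ (y E.∘ x) B.≈ p.F₁ z →
            (g B.∘ p.F₁ y) B.∘ p.F₁ x B.≈ p.F₁ z
    split h = B.Equiv.trans (B.pullʳ (B.Equiv.sym p.homomorphism)) h
    inner : ∀ {W} (z : _ E.⇒ W) g → g B.∘ p.F₁ (y E.∘ x) B.≈ p.F₁ z → _ E.⇒ W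
    inner z g h = x.factor z (g B.∘ p.F₁ y) (split h)
    inner-over : ∀ {W} (z : _ E.⇒ W) g h → g B.∘ p.F₁ y B.≈ p.F₁ (inner z g h)
    inner-over z g h = B.Equiv.sym (x.over z (g B.∘ p.F₁ y) (split h))

  -- The endpoints of `f` and `g` are variables, so that matching on `≋` identifies them with images
  -- under `p` and no transport along object equalities appears.
  opcartesian-factor-≋ : ∀ {X Y Z a b c} {x : X E.⇒ Y} {z : X E.⇒ Z}
                         {f : a B.⇒ b} {g : b B.⇒ c} →
                         IsOpcartesian p x → p.F₁ x B.≋ f → p.F₁ z B.≋ g B.∘ f →
                         Σ[ y ∈ Y E.⇒ Z ] (p.F₁ y B.≋ g) × (y E.∘ x E.≈ z)
  opcartesian-factor-≋ {z = z} {g = g} x-opc (B.≈⇒≋ s) (B.≈⇒≋ t) =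
    factor z g h , B.≈⇒≋ (over z g h) , commutes z g h
    where
    open IsOpcartesian x-opc
    h = B.Equiv.trans (B.refl⟩∘⟨ s) (B.Equiv.sym t)

  -- Both arrows are factorizations of `y′ ∘ x` through `x` over `p y′`.
  opcartesian-cancel : ∀ {X Y Z} {x : X E.⇒ Y} {y y′ : Y E.⇒ Z} → IsOpcartesian p x →
                       p.F₁ y B.≈ p.F₁ y′ → y E.∘ x E.≈ y′ E.∘ x → y E.≈ y′
  opcartesian-cancel {x = x} {y} {y′} x-opc s t = E.Equiv.trans
    (unique (y′ E.∘ x) (p.F₁ y′) h y s t)
    (E.Equiv.sym (unique (y′ E.∘ x) (p.F₁ y′) h y′ B.Equiv.refl E.Equiv.refl))
    where
    open IsOpcartesian x-opc
    h = B.Equiv.sym p.homomorphism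

  opcartesian-lift-≋ : IsOpfibration p → ∀ X {a b} (f : a B.⇒ b) → p.F₀ X ≡ a →
                       Σ[ Y ∈ E.Obj ] Σ[ x ∈ X E.⇒ Y ] (p.F₁ x B.≋ f) × IsOpcartesian p x
  opcartesian-lift-≋ opf X f refl = opf X f

-- Actegories and strict equivariant functors.

module ActegoryProperties {oM ℓM eM o ℓ e : Level} {M : MonoidalCategory oM ℓM eM}
                          (A : Actegory M o ℓ e) where
  private
    module M = MonoidalCategory M
  open Actegory A
  private
    module act = Functor act

  ·-homomorphism : ∀ {m n k c d b} {u : m M.⇒ n} {v : n M.⇒ k} {f : c ⇒ d} {g : d ⇒ b} →
                   (v ·₁ g) ∘ (u ·₁ f) ≈ (v M.∘ u) ·₁ (g ∘ f)
  ·-homomorphism = Equiv.sym act.homomorphism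

  id·-homomorphism : ∀ {m c d b} {f : c ⇒ d} {g : d ⇒ b} →
                     (M.id {m} ·₁ g) ∘ (M.id ·₁ f) ≈ M.id ·₁ (g ∘ f)
  id·-homomorphism =
    Equiv.trans ·-homomorphism (act.F-resp-≈ (M.identityˡ , Equiv.refl))

  ·-resp-≋ : ∀ {m n c d c′ d′} (u : m M.⇒ n) {f : c ⇒ d} {g : c′ ⇒ d′} →
             f ≋ g → u ·₁ f ≋ u ·₁ g
  ·-resp-≋ u (≈⇒≋ p) = ≈⇒≋ (act.F-resp-≈ (M.Equiv.refl , p))

  η-cong : ∀ {c d} → c ≡ d → η c ≋ η d
  η-cong refl = ≈⇒≋ Equiv.refl

  μ-cong : ∀ {m n c d} → c ≡ d → μ m n c ≋ μ m n d
  μ-cong refl = ≈⇒≋ Equiv.refl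

module StrictProperties {oM ℓM eM o ℓ e o′ ℓ′ e′ : Level} {M : MonoidalCategory oM ℓM eM}
    {E : Actegory M o ℓ e} {B : Actegory M o′ ℓ′ e′}
    {p : Functor (Actegory.category E) (Actegory.category B)}
    (strict : StrictEquivariant E B p) where
  private
    module M = MonoidalCategory M
    module E = Actegory E
    module B where
      open Actegory B public
      open CategoryProperties category public
      open ActegoryProperties B public
    module p = Functor p
  open StrictEquivariant strict

  strict-obj : ∀ m X → p.F₀ (m E.·₀ X) ≡ m B.·₀ p.F₀ X
  strict-obj m X = B.≋-cod (φ-identity m X)

  -- This is naturality of `φ` with the identity component deleted on each side.
  strict-· : ∀ {m n X Y} (u : m M.⇒ n) (x : X E.⇒ Y) → p.F₁ (u E.·₁ x) B.≋ u B.·₁ p.F₁ x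
  strict-· {m} {n} {X} {Y} u x =
    B.≋-trans (B.≋-sym (B.≋-∘-id (φ-identity m X)))
    (B.≋-trans (B.≋-sym (B.≈⇒≋ (φ-natural u x)))
    (B.≋-id-∘ (φ-identity n Y)))

  strict-η : ∀ X → p.F₁ (E.η X) B.≋ B.η (p.F₀ X)
  strict-η X = B.≋-trans (B.≋-sym (B.≋-∘-id (φ-identity _ X))) (B.≈⇒≋ (φ-η X))

  strict-μ : ∀ m n X → p.F₁ (E.μ m n X) B.≋ B.μ m n (p.F₀ X)
  strict-μ m n X =
    B.≋-trans (B.≋-sym (B.≋-∘-id (φ-identity _ X)))
    (B.≋-trans (B.≈⇒≋ (φ-μ m n X))
    (B.≋-trans (B.≋-id-∘ (φ-identity m _))
    -- The last component of `φ` sits under the action; `id · φ` is an identity by functoriality.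
    (B.≋-id-∘ (B.≋-trans (B.·-resp-≋ M.id (φ-identity n X))
                         (B.≈⇒≋ (Functor.identity B.act))))))

-- Morphisms of the pullback out of an opcartesian lift.

module _ {oC ℓC eC oE ℓE eE oB ℓB eB : Level}
         {C : Category oC ℓC eC} {E : Category oE ℓE eE} {B : Category oB ℓB eB}
         (Γ : Functor C B) (p : Functor E B) where
  private
    module C where
      open Category C public
      open CategoryProperties C public
    module E where
      open Category E public
      open CategoryProperties E public
    module B where
      open Category B public
      open CategoryProperties B public
    module Γ = Functor Γ
    module p = Functor p
    module G = Category (Pullback Γ p)
    open module Obj = PullbackObj {Γ = Γ} {p = p}
    open module Hom = PullbackHom {Γ = Γ} {p = p}

  opaque
    -- The component in `C` is prescribed as `h`, so only the component in `E` has to be found: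
    -- factor `z` through `l` over `Γ h`.
    pullback-factor : ∀ {P Q X a} {l : X E.⇒ total P} {f : a B.⇒ Γ.F₀ (base P)} →
                      IsOpcartesian p l → p.F₁ l B.≋ f →
                      (h : base P C.⇒ base Q) (z : X E.⇒ total Q) →
                      p.F₁ z B.≋ Γ.F₁ h B.∘ f →
                      Σ[ x ∈ total P E.⇒ total Q ] (Γ.F₁ h B.≋ p.F₁ x) × (x E.∘ l E.≈ z)
    pullback-factor l-opc s h z t with opcartesian-factor-≋ p l-opc s t
    ... | x , px≋Γh , x∘l≈z = x , B.≋-sym px≋Γh , x∘l≈z

  -- Equal components in `C` force the components in `E` to lie over the same arrow of `B`, so
  -- cancellation of `l` applies.
  pullback-cancel : ∀ {P Q X} {l : X E.⇒ total P} → IsOpcartesian p l →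
                    (k k′ : P G.⇒ Q) → base₁ k C.≈ base₁ k′ →
                    total₁ k E.∘ l E.≈ total₁ k′ E.∘ l → k G.≈ k′
  pullback-cancel l-opc k k′ s t = s , opcartesian-cancel p l-opc
    (B.≋⇒≈ (B.≋-trans (B.≋-sym (agree₁ k))
           (B.≋-trans (B.≈⇒≋ (Γ.F-resp-≈ s)) (agree₁ k′)))) t

  -- The inverse factors `l` through `l′` over the image under `Γ` of the inverse in `C`. Both
  -- composites are then recognized as identities by cancelling `l` and `l′`.
  pullback-iso : ∀ {P Q X a} {l : X E.⇒ total P} {l′ : X E.⇒ total Q}
                 {f : a B.⇒ Γ.F₀ (base P)} →
                 IsOpcartesian p l → IsOpcartesian p l′ → p.F₁ l B.≋ f →
                 (k : P G.⇒ Q) → C.IsIso (base₁ k) → total₁ k E.∘ l E.≈ l′ → G.IsIso k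
  pullback-iso {P} {Q} {l = l} {l′} {f} l-opc l′-opc s k base-iso k∘l≈l′ = record
    { inv  = k⁻¹
    ; isoˡ = pullback-cancel l-opc (k⁻¹ G.∘ k) G.id isoˡ (begin
        (x E.∘ total₁ k) E.∘ l     ≈⟨ E.pullʳ k∘l≈l′ ⟩
        x E.∘ l′                   ≈⟨ x∘l′≈l ⟩
        l                          ≈⟨ E.identityˡ ⟨
        E.id E.∘ l                 ∎)
    ; isoʳ = pullback-cancel l′-opc (k G.∘ k⁻¹) G.id isoʳ (begin
        (total₁ k E.∘ x) E.∘ l′    ≈⟨ E.pullʳ x∘l′≈l ⟩
        total₁ k E.∘ l             ≈⟨ k∘l≈l′ ⟩
        l′                         ≈⟨ E.identityˡ ⟨
        E.id E.∘ l′                ∎)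
    }
    where
    open C.IsIso base-iso
    open E.≈-Reasoning
    l′-over : p.F₁ l′ B.≋ Γ.F₁ (base₁ k) B.∘ f
    l′-over = B.≋-trans (B.≈⇒≋ (B.Equiv.trans (p.F-resp-≈ (E.Equiv.sym k∘l≈l′)) p.homomorphism))
                        (B.∘-resp-≋ (B.≋-sym (agree₁ k)) s)
    l-over : p.F₁ l B.≋ Γ.F₁ inv B.∘ (Γ.F₁ (base₁ k) B.∘ f)
    l-over = B.≋-trans s (B.≈⇒≋ (B.Equiv.sym (B.cancelˡ
      (B.Equiv.trans (B.Equiv.sym Γ.homomorphism)
        (B.Equiv.trans (Γ.F-resp-≈ isoˡ) Γ.identity)))))
    filler = pullback-factor {P = Q} {Q = P} l′-opc l′-over inv l l-over
    x = proj₁ filler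
    x∘l′≈l = proj₂ (proj₂ filler)
    k⁻¹ : Q G.⇒ P
    k⁻¹ = hom inv x (proj₁ (proj₂ filler))

-- The action functor from chosen opcartesian lifts.

module PullbackAction {oM ℓM eM oB ℓB eB oC ℓC eC oE ℓE eE : Level}
    (M : MonoidalCategory oM ℓM eM)
    (B : Actegory M oB ℓB eB) (C : Actegory M oC ℓC eC) (E : Actegory M oE ℓE eE)
    (Γ : Functor (Actegory.category C) (Actegory.category B))
    (Γ-lax : LaxEquivariant C B Γ)
    (p : Functor (Actegory.category E) (Actegory.category B))
    (p-strict : StrictEquivariant E B p)
    (p-opf : IsOpfibration p)
    (act-opcartesian : ∀ m → PreservesOpcartesian p (actOn E m)) where
  private
    module M = MonoidalCategory M
    module B where
      open Actegory B public
      open CategoryProperties category public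
      open ActegoryProperties B public
    module C where
      open Actegory C public
      open CategoryProperties category public
    module E where
      open Actegory E public
      open CategoryProperties category public
      open ActegoryProperties E public
      module act = Functor act
    module Γ where
      open Functor Γ public
      open LaxEquivariant Γ-lax public
    module p where
      open Functor p public
      open StrictProperties p-strict public
    module G = Category (Pullback Γ p)
    open module Obj = PullbackObj {Γ = Γ} {p = p}
    open module Hom = PullbackHom {Γ = Γ} {p = p}
    open M using (I; _⊗₀_; _⊗₁_)
    open E using (_≈_; _∘_; _·₁_; refl⟩∘⟨_; _⟩∘⟨refl; pullˡ; pullʳ)
    open E.≈-Reasoning

  opaque
    lift : ∀ m P → Σ[ Y ∈ E.Obj ] Σ[ x ∈ (m E.·₀ total P) E.⇒ Y ]
                   (p.F₁ x B.≋ Γ.φ m (base P)) × IsOpcartesian p x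
    lift m P = opcartesian-lift-≋ p p-opf (m E.·₀ total P) (Γ.φ m (base P))
      (trans (p.strict-obj m (total P)) (cong (m B.·₀_) (sym (agree P))))

  infixr 10 _⊙₀_

  -- The component in `C` is `m · C` on the nose, which later makes the projection strict. The
  -- agreement over `B` is the codomain half of the `≋` that comes with the lift.
  _⊙₀_ : M.Obj → G.Obj → G.Obj
  m ⊙₀ P = obj (m C.·₀ base P) (proj₁ (lift m P))
               (sym (B.≋-cod (proj₁ (proj₂ (proj₂ (lift m P))))))

  -- These lifts act as a lax equivariant structure on the other projection, to `E`: `λ⊙-natural`,
  -- `η⊙-λ⊙` and `μ⊙-λ⊙` are its laws.
  λ⊙ : ∀ m P → (m E.·₀ total P) E.⇒ total (m ⊙₀ P)
  λ⊙ m P = proj₁ (proj₂ (lift m P))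

  λ⊙-over : ∀ m P → p.F₁ (λ⊙ m P) B.≋ Γ.φ m (base P)
  λ⊙-over m P = proj₁ (proj₂ (proj₂ (lift m P)))

  λ⊙-opcartesian : ∀ m P → IsOpcartesian p (λ⊙ m P)
  λ⊙-opcartesian m P = proj₂ (proj₂ (proj₂ (lift m P)))

  module _ {m P Q} (h : base (m ⊙₀ P) C.⇒ base Q) (z : (m E.·₀ total P) E.⇒ total Q)
           (z-over : p.F₁ z B.≋ Γ.F₁ h B.∘ Γ.φ m (base P)) where
    private
      filler = pullback-factor Γ p {P = m ⊙₀ P} {Q = Q} (λ⊙-opcartesian m P)
                 (λ⊙-over m P) h z z-over

    -- Since `z-over` mentions `Γ.φ`, its instances for the functor, the unit and the multiplication
    -- reduce to the three laws of the lax structure on `Γ`.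
    induced : m ⊙₀ P G.⇒ Q
    induced = hom h (proj₁ filler) (proj₁ (proj₂ filler))

    induced-λ⊙ : total₁ induced ∘ λ⊙ m P ≈ z
    induced-λ⊙ = proj₂ (proj₂ filler)

  -- Every law of the new action splits this way into the same law for `C` and a computation in `E`
  -- after precomposition with a lift.
  ⊙-ext : ∀ {m P Q} (k k′ : m ⊙₀ P G.⇒ Q) → base₁ k C.≈ base₁ k′ →
          total₁ k ∘ λ⊙ m P ≈ total₁ k′ ∘ λ⊙ m P → k G.≈ k′
  ⊙-ext {m} {P} {Q} = pullback-cancel Γ p {P = m ⊙₀ P} {Q = Q} (λ⊙-opcartesian m P)

  module _ {m n P Q} (u : m M.⇒ n) (k : P G.⇒ Q) where
    private
      z-over : p.F₁ (λ⊙ n Q ∘ (u ·₁ total₁ k)) B.≋ Γ.F₁ (u C.·₁ base₁ k) B.∘ Γ.φ m (base P)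
      z-over =
        B.≋-trans (B.≈⇒≋ p.homomorphism)
        -- Strictness of `p` turns the image of `u · x` into `u · Γ f`, where naturality of `φ`
        -- applies.
        (B.≋-trans (B.∘-resp-≋ (λ⊙-over n Q)
          (B.≋-trans (p.strict-· u (total₁ k)) (B.·-resp-≋ u (B.≋-sym (agree₁ k)))))
        (B.≈⇒≋ (Γ.φ-natural u (base₁ k))))

    infixr 10 _⊙₁_

    _⊙₁_ : m ⊙₀ P G.⇒ n ⊙₀ Q
    _⊙₁_ = induced (u C.·₁ base₁ k) (λ⊙ n Q ∘ (u ·₁ total₁ k)) z-over

    λ⊙-natural : total₁ _⊙₁_ ∘ λ⊙ m P ≈ λ⊙ n Q ∘ (u ·₁ total₁ k)
    λ⊙-natural = induced-λ⊙ {Q = n ⊙₀ Q} (u C.·₁ base₁ k) (λ⊙ n Q ∘ (u ·₁ total₁ k)) z-over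

  ⊙ : Functor (M.category ⊠ Pullback Γ p) (Pullback Γ p)
  ⊙ = record
    { F₀           = λ (m , P) → m ⊙₀ P
    ; F₁           = λ (u , k) → u ⊙₁ k
    ; identity     = λ { {m , P} → ⊙-ext (M.id ⊙₁ G.id) G.id (Functor.identity C.act) (begin
        total₁ (M.id ⊙₁ G.id {P}) ∘ λ⊙ m P     ≈⟨ λ⊙-natural M.id G.id ⟩
        λ⊙ m P ∘ (M.id ·₁ E.id)                ≈⟨ refl⟩∘⟨ E.act.identity ⟩
        λ⊙ m P ∘ E.id                          ≈⟨ E.identityʳ ⟩
        λ⊙ m P                                 ≈⟨ E.identityˡ ⟨
        E.id ∘ λ⊙ m P                          ∎) }
    ; homomorphism = λ { {l , P} {m , Q} {n , R} {u , k} {v , k′} →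
        ⊙-ext ((v M.∘ u) ⊙₁ (k′ G.∘ k)) ((v ⊙₁ k′) G.∘ (u ⊙₁ k)) (Functor.homomorphism C.act) (begin
        total₁ ((v M.∘ u) ⊙₁ (k′ G.∘ k)) ∘ λ⊙ l P           ≈⟨ λ⊙-natural (v M.∘ u) (k′ G.∘ k) ⟩
        λ⊙ n R ∘ ((v M.∘ u) ·₁ (total₁ k′ ∘ total₁ k))      ≈⟨ refl⟩∘⟨ E.act.homomorphism ⟩
        λ⊙ n R ∘ ((v ·₁ total₁ k′) ∘ (u ·₁ total₁ k))       ≈⟨ pullˡ (E.Equiv.sym (λ⊙-natural v k′)) ⟩
        (total₁ (v ⊙₁ k′) ∘ λ⊙ m Q) ∘ (u ·₁ total₁ k)       ≈⟨ pullʳ (E.Equiv.sym (λ⊙-natural u k)) ⟩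
        total₁ (v ⊙₁ k′) ∘ (total₁ (u ⊙₁ k) ∘ λ⊙ l P)       ≈⟨ E.sym-assoc ⟩
        (total₁ (v ⊙₁ k′) ∘ total₁ (u ⊙₁ k)) ∘ λ⊙ l P       ∎) }
    ; F-resp-≈     = λ { {m , P} {n , Q} {u , k} {v , k′} (u≈v , (s , t)) →
        ⊙-ext (u ⊙₁ k) (v ⊙₁ k′) (Functor.F-resp-≈ C.act (u≈v , s)) (begin
        total₁ (u ⊙₁ k) ∘ λ⊙ m P       ≈⟨ λ⊙-natural u k ⟩
        λ⊙ n Q ∘ (u ·₁ total₁ k)       ≈⟨ refl⟩∘⟨ E.act.F-resp-≈ (u≈v , t) ⟩
        λ⊙ n Q ∘ (v ·₁ total₁ k′)      ≈⟨ λ⊙-natural v k′ ⟨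
        total₁ (v ⊙₁ k′) ∘ λ⊙ m P      ∎) }
    }

  -- Unit and multiplication, with their invertibility.

  module _ (P : G.Obj) where
    private
      z-over : p.F₁ (E.η (total P)) B.≋ Γ.F₁ (C.η (base P)) B.∘ Γ.φ I (base P)
      z-over =
        B.≋-trans (p.strict-η (total P))
        (B.≋-trans (B.η-cong (sym (agree P)))
        (B.≋-sym (B.≈⇒≋ (Γ.φ-η (base P)))))

    η⊙ : I ⊙₀ P G.⇒ P
    η⊙ = induced (C.η (base P)) (E.η (total P)) z-over

    η⊙-λ⊙ : total₁ η⊙ ∘ λ⊙ I P ≈ E.η (total P)
    η⊙-λ⊙ = induced-λ⊙ {Q = P} (C.η (base P)) (E.η (total P)) z-over

    η⊙-iso : G.IsIso η⊙
    η⊙-iso = pullback-iso Γ p {P = I ⊙₀ P} {Q = P} (λ⊙-opcartesian I P)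
               (iso⇒opcartesian p (E.η-iso (total P)))
               (λ⊙-over I P) η⊙ (C.η-iso (base P)) η⊙-λ⊙

  module _ (m n : M.Obj) (P : G.Obj) where
    private
      z : ((m ⊗₀ n) E.·₀ total P) E.⇒ total (m ⊙₀ (n ⊙₀ P))
      z = λ⊙ m (n ⊙₀ P) ∘ ((M.id ·₁ λ⊙ n P) ∘ E.μ m n (total P))

      z-over : p.F₁ z B.≋ Γ.F₁ (C.μ m n (base P)) B.∘ Γ.φ (m ⊗₀ n) (base P)
      z-over =
        B.≋-trans (B.≈⇒≋ (B.Equiv.trans p.homomorphism (B.refl⟩∘⟨ p.homomorphism)))
        -- The three factors of `z` lie over the three factors on the right of `φ-μ` for `Γ`.
        (B.≋-trans (B.∘-resp-≋ (λ⊙-over m (n ⊙₀ P)) (B.∘-resp-≋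
          (B.≋-trans (p.strict-· M.id (λ⊙ n P)) (B.·-resp-≋ M.id (λ⊙-over n P)))
          (B.≋-trans (p.strict-μ m n (total P)) (B.μ-cong (sym (agree P))))))
        (B.≋-sym (B.≈⇒≋ (Γ.φ-μ m n (base P)))))

    μ⊙ : (m ⊗₀ n) ⊙₀ P G.⇒ m ⊙₀ (n ⊙₀ P)
    μ⊙ = induced (C.μ m n (base P)) z z-over

    μ⊙-λ⊙ : total₁ μ⊙ ∘ λ⊙ (m ⊗₀ n) P
            ≈ λ⊙ m (n ⊙₀ P) ∘ ((M.id ·₁ λ⊙ n P) ∘ E.μ m n (total P))
    μ⊙-λ⊙ = induced-λ⊙ {Q = m ⊙₀ (n ⊙₀ P)} (C.μ m n (base P)) z z-over

    μ⊙-iso : G.IsIso μ⊙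
    μ⊙-iso = pullback-iso Γ p {P = (m ⊗₀ n) ⊙₀ P} {Q = m ⊙₀ (n ⊙₀ P)}
      (λ⊙-opcartesian (m ⊗₀ n) P)
      (opcartesian-∘ p (λ⊙-opcartesian m (n ⊙₀ P))
        -- The preservation hypothesis enters here: acting by `m` keeps the inner lift opcartesian.
        (opcartesian-∘ p (act-opcartesian m (λ⊙ n P) (λ⊙-opcartesian n P))
          (iso⇒opcartesian p (E.μ-iso m n (total P)))))
      (λ⊙-over (m ⊗₀ n) P) μ⊙ (C.μ-iso m n (base P)) μ⊙-λ⊙

  -- Naturality and coherence.

  η⊙-natural : ∀ {P Q} (k : P G.⇒ Q) → η⊙ Q G.∘ (M.id ⊙₁ k) G.≈ k G.∘ η⊙ P
  η⊙-natural {P} {Q} k = ⊙-ext (η⊙ Q G.∘ (M.id ⊙₁ k)) (k G.∘ η⊙ P) (C.η-natural (base₁ k)) (begin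
    (total₁ (η⊙ Q) ∘ total₁ (M.id ⊙₁ k)) ∘ λ⊙ I P    ≈⟨ pullʳ (λ⊙-natural M.id k) ⟩
    total₁ (η⊙ Q) ∘ (λ⊙ I Q ∘ (M.id ·₁ total₁ k))    ≈⟨ pullˡ (η⊙-λ⊙ Q) ⟩
    E.η (total Q) ∘ (M.id ·₁ total₁ k)               ≈⟨ E.η-natural (total₁ k) ⟩
    total₁ k ∘ E.η (total P)                         ≈⟨ pullʳ (η⊙-λ⊙ P) ⟨
    (total₁ k ∘ total₁ (η⊙ P)) ∘ λ⊙ I P              ∎)

  -- This carries a known computation of `k` on an inner arrow `w` through an outer lift. Naturality
  -- of `μ⊙` and both coherence laws use it, with `w` an inner lift.
  ⊙₁-λ⊙-· : ∀ {l m P Q X Z} (u : l M.⇒ m) (k : P G.⇒ Q) {w : X E.⇒ total P}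
            {z : X E.⇒ total Q} {y : Z E.⇒ (l E.·₀ X)} → total₁ k ∘ w ≈ z →
            total₁ (u ⊙₁ k) ∘ (λ⊙ l P ∘ ((M.id ·₁ w) ∘ y)) ≈ λ⊙ m Q ∘ ((u ·₁ z) ∘ y)
  ⊙₁-λ⊙-· {l} {m} {P} {Q} u k {w} {z} {y} k∘w≈z = begin
    total₁ (u ⊙₁ k) ∘ (λ⊙ l P ∘ ((M.id ·₁ w) ∘ y))    ≈⟨ pullˡ (λ⊙-natural u k) ⟩
    (λ⊙ m Q ∘ (u ·₁ total₁ k)) ∘ ((M.id ·₁ w) ∘ y)    ≈⟨ pullʳ (pullˡ E.·-homomorphism) ⟩
    λ⊙ m Q ∘ (((u M.∘ M.id) ·₁ (total₁ k ∘ w)) ∘ y)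
      ≈⟨ refl⟩∘⟨ E.act.F-resp-≈ (M.identityʳ , k∘w≈z) ⟩∘⟨refl ⟩
    λ⊙ m Q ∘ ((u ·₁ z) ∘ y)                           ∎

  μ⊙-natural : ∀ {m n m′ n′ P Q} (u : m M.⇒ m′) (v : n M.⇒ n′) (k : P G.⇒ Q) →
               μ⊙ m′ n′ Q G.∘ ((u ⊗₁ v) ⊙₁ k) G.≈ (u ⊙₁ (v ⊙₁ k)) G.∘ μ⊙ m n P
  μ⊙-natural {m} {n} {m′} {n′} {P} {Q} u v k =
    ⊙-ext (μ⊙ m′ n′ Q G.∘ ((u ⊗₁ v) ⊙₁ k)) ((u ⊙₁ (v ⊙₁ k)) G.∘ μ⊙ m n P)
      (C.μ-natural u v (base₁ k)) (begin
    (total₁ (μ⊙ m′ n′ Q) ∘ total₁ ((u ⊗₁ v) ⊙₁ k)) ∘ λ⊙ (m ⊗₀ n) P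
      ≈⟨ pullʳ (λ⊙-natural (u ⊗₁ v) k) ⟩
    total₁ (μ⊙ m′ n′ Q) ∘ (λ⊙ (m′ ⊗₀ n′) Q ∘ ((u ⊗₁ v) ·₁ total₁ k))
      ≈⟨ pullˡ (μ⊙-λ⊙ m′ n′ Q) ⟩
    (λ⊙ m′ (n′ ⊙₀ Q) ∘ ((M.id ·₁ λ⊙ n′ Q) ∘ E.μ m′ n′ (total Q))) ∘ ((u ⊗₁ v) ·₁ total₁ k)
      ≈⟨ pullʳ (pullʳ (E.μ-natural u v (total₁ k))) ⟩
    λ⊙ m′ (n′ ⊙₀ Q) ∘ ((M.id ·₁ λ⊙ n′ Q) ∘ ((u ·₁ (v ·₁ total₁ k)) ∘ E.μ m n (total P)))
      -- Merging the two actions exposes `λ⊙ ∘ (v · x)`, which is `v ⊙₁ k` after the inner lift.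
      ≈⟨ refl⟩∘⟨ pullˡ (E.Equiv.trans E.·-homomorphism
           (E.act.F-resp-≈ (M.identityˡ , E.Equiv.refl))) ⟩
    λ⊙ m′ (n′ ⊙₀ Q) ∘ ((u ·₁ (λ⊙ n′ Q ∘ (v ·₁ total₁ k))) ∘ E.μ m n (total P))
      ≈⟨ ⊙₁-λ⊙-· u (v ⊙₁ k) (λ⊙-natural v k) ⟨
    total₁ (u ⊙₁ (v ⊙₁ k)) ∘ (λ⊙ m (n ⊙₀ P) ∘ ((M.id ·₁ λ⊙ n P) ∘ E.μ m n (total P)))
      ≈⟨ pullʳ (μ⊙-λ⊙ m n P) ⟨
    (total₁ (u ⊙₁ (v ⊙₁ k)) ∘ total₁ (μ⊙ m n P)) ∘ λ⊙ (m ⊗₀ n) P ∎)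

  -- On the lift, both sides become the three nested lifts for `m₃`, `m₂`, `m₁` preceded by the
  -- corresponding side of the associativity law in `E`.
  μ⊙-assoc : ∀ m₁ m₂ m₃ P →
             μ⊙ m₁ m₂ (m₃ ⊙₀ P) G.∘ μ⊙ (m₁ ⊗₀ m₂) m₃ P
             G.≈ (M.id ⊙₁ μ⊙ m₂ m₃ P) G.∘ (μ⊙ m₁ (m₂ ⊗₀ m₃) P G.∘ (M.α m₁ m₂ m₃ ⊙₁ G.id))
  μ⊙-assoc m₁ m₂ m₃ P =
    ⊙-ext (μ⊙ m₁ m₂ (m₃ ⊙₀ P) G.∘ μ⊙ (m₁ ⊗₀ m₂) m₃ P)
          ((M.id ⊙₁ μ⊙ m₂ m₃ P) G.∘ (μ⊙ m₁ (m₂ ⊗₀ m₃) P G.∘ (M.α m₁ m₂ m₃ ⊙₁ G.id)))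
      (C.μ-assoc m₁ m₂ m₃ (base P)) (begin
    (total₁ (μ⊙ m₁ m₂ P₃) ∘ total₁ (μ⊙ (m₁ ⊗₀ m₂) m₃ P)) ∘ λ⊙ ((m₁ ⊗₀ m₂) ⊗₀ m₃) P
      ≈⟨ pullʳ (μ⊙-λ⊙ (m₁ ⊗₀ m₂) m₃ P) ⟩
    total₁ (μ⊙ m₁ m₂ P₃) ∘ (λ⊙ (m₁ ⊗₀ m₂) P₃ ∘ ((M.id ·₁ λ⊙ m₃ P) ∘ E.μ (m₁ ⊗₀ m₂) m₃ X))
      ≈⟨ pullˡ (μ⊙-λ⊙ m₁ m₂ P₃) ⟩
    (λ⊙ m₁ P₂₃ ∘ ((M.id ·₁ λ⊙ m₂ P₃) ∘ E.μ m₁ m₂ (total P₃)))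
      ∘ ((M.id ·₁ λ⊙ m₃ P) ∘ E.μ (m₁ ⊗₀ m₂) m₃ X)
      -- Sliding `μ` past the innermost lift brings the two multiplications of `E` together.
      ≈⟨ pullʳ (pullʳ (pullˡ μ-natural-id)) ⟩
    λ⊙ m₁ P₂₃ ∘ ((M.id ·₁ λ⊙ m₂ P₃) ∘
      (((M.id ·₁ (M.id ·₁ λ⊙ m₃ P)) ∘ E.μ m₁ m₂ (m₃ E.·₀ X)) ∘ E.μ (m₁ ⊗₀ m₂) m₃ X))
      ≈⟨ refl⟩∘⟨ refl⟩∘⟨ pullʳ (E.μ-assoc m₁ m₂ m₃ X) ⟩
    λ⊙ m₁ P₂₃ ∘ ((M.id ·₁ λ⊙ m₂ P₃) ∘ ((M.id ·₁ (M.id ·₁ λ⊙ m₃ P)) ∘ ((M.id ·₁ E.μ m₂ m₃ X) ∘ y)))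
      ≈⟨ refl⟩∘⟨ refl⟩∘⟨ pullˡ E.id·-homomorphism ⟩
    λ⊙ m₁ P₂₃ ∘ ((M.id ·₁ λ⊙ m₂ P₃) ∘ ((M.id ·₁ ((M.id ·₁ λ⊙ m₃ P) ∘ E.μ m₂ m₃ X)) ∘ y))
      ≈⟨ refl⟩∘⟨ pullˡ E.id·-homomorphism ⟩
    λ⊙ m₁ P₂₃ ∘ ((M.id ·₁ (λ⊙ m₂ P₃ ∘ ((M.id ·₁ λ⊙ m₃ P) ∘ E.μ m₂ m₃ X))) ∘ y)
      ≈⟨ ⊙₁-λ⊙-· M.id (μ⊙ m₂ m₃ P) (μ⊙-λ⊙ m₂ m₃ P) ⟨
    total₁ (M.id {m₁} ⊙₁ μ⊙ m₂ m₃ P) ∘ (λ⊙ m₁ ((m₂ ⊗₀ m₃) ⊙₀ P) ∘ ((M.id ·₁ λ⊙ (m₂ ⊗₀ m₃) P) ∘ y))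
      -- The associator is split off so that the rest is the right side of `μ⊙-λ⊙`.
      ≈⟨ refl⟩∘⟨ E.Equiv.trans (refl⟩∘⟨ E.sym-assoc) E.sym-assoc ⟩
    total₁ (M.id {m₁} ⊙₁ μ⊙ m₂ m₃ P) ∘
      ((λ⊙ m₁ ((m₂ ⊗₀ m₃) ⊙₀ P) ∘ ((M.id ·₁ λ⊙ (m₂ ⊗₀ m₃) P) ∘ E.μ m₁ (m₂ ⊗₀ m₃) X))
        ∘ (M.α m₁ m₂ m₃ ·₁ E.id))
      ≈⟨ refl⟩∘⟨ pullˡ (μ⊙-λ⊙ m₁ (m₂ ⊗₀ m₃) P) ⟨
    total₁ (M.id {m₁} ⊙₁ μ⊙ m₂ m₃ P) ∘
      (total₁ (μ⊙ m₁ (m₂ ⊗₀ m₃) P) ∘ (λ⊙ (m₁ ⊗₀ (m₂ ⊗₀ m₃)) P ∘ (M.α m₁ m₂ m₃ ·₁ E.id)))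
      ≈⟨ pullʳ (pullʳ (λ⊙-natural (M.α m₁ m₂ m₃) G.id)) ⟨
    (total₁ (M.id {m₁} ⊙₁ μ⊙ m₂ m₃ P) ∘
      (total₁ (μ⊙ m₁ (m₂ ⊗₀ m₃) P) ∘ total₁ (M.α m₁ m₂ m₃ ⊙₁ G.id {P}))) ∘ λ⊙ ((m₁ ⊗₀ m₂) ⊗₀ m₃) P ∎)
    where
    X = total P
    P₃ = m₃ ⊙₀ P
    P₂₃ = m₂ ⊙₀ P₃
    y = E.μ m₁ (m₂ ⊗₀ m₃) X ∘ (M.α m₁ m₂ m₃ ·₁ E.id)
    μ-natural-id : E.μ m₁ m₂ (total P₃) ∘ (M.id ·₁ λ⊙ m₃ P)
                   ≈ (M.id ·₁ (M.id ·₁ λ⊙ m₃ P)) ∘ E.μ m₁ m₂ (m₃ E.·₀ X)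
    μ-natural-id = E.Equiv.trans
      -- Naturality of `μ` expects `id ⊗ id` as the acting arrow.
      (refl⟩∘⟨ E.act.F-resp-≈ (M.Equiv.sym (Functor.identity M.⊗) , E.Equiv.refl))
      (E.μ-natural M.id M.id (λ⊙ m₃ P))

  μ⊙-unit : ∀ m P → (M.id ⊙₁ η⊙ P) G.∘ μ⊙ m I P G.≈ M.r m ⊙₁ G.id
  μ⊙-unit m P =
    ⊙-ext ((M.id ⊙₁ η⊙ P) G.∘ μ⊙ m I P) (M.r m ⊙₁ G.id) (C.μ-unit m (base P)) (begin
    (total₁ (M.id {m} ⊙₁ η⊙ P) ∘ total₁ (μ⊙ m I P)) ∘ λ⊙ (m ⊗₀ I) P
      ≈⟨ pullʳ (μ⊙-λ⊙ m I P) ⟩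
    total₁ (M.id {m} ⊙₁ η⊙ P) ∘ (λ⊙ m (I ⊙₀ P) ∘ ((M.id ·₁ λ⊙ I P) ∘ E.μ m I (total P)))
      ≈⟨ ⊙₁-λ⊙-· M.id (η⊙ P) (η⊙-λ⊙ P) ⟩
    λ⊙ m P ∘ ((M.id ·₁ E.η (total P)) ∘ E.μ m I (total P))
      ≈⟨ refl⟩∘⟨ E.μ-unit m (total P) ⟩
    λ⊙ m P ∘ (M.r m ·₁ E.id)
      ≈⟨ λ⊙-natural (M.r m) G.id ⟨
    total₁ (M.r m ⊙₁ G.id {P}) ∘ λ⊙ (m ⊗₀ I) P ∎)

  -- The action on the pullback and strictness of its projection.

  action : Action M (Pullback Γ p)
  action = record
    { act       = ⊙
    ; η         = η⊙
    ; μ         = μ⊙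
    ; η-natural = η⊙-natural
    ; μ-natural = μ⊙-natural
    ; η-iso     = η⊙-iso
    ; μ-iso     = μ⊙-iso
    ; μ-assoc   = μ⊙-assoc
    ; μ-unit    = μ⊙-unit
    }

  proj-strict : StrictEquivariant (actegory (Pullback Γ p) action) C (pullbackProj Γ p)
  proj-strict = record
    { laxEquivariant = record
      -- The components in `C` of the new action and of `η⊙` and `μ⊙` are those of `C` by
      -- definition, so only identity laws remain.
      { φ         = λ m P → C.id
      ; φ-natural = λ u k → C.Equiv.trans C.identityˡ (C.Equiv.sym C.identityʳ)
      ; φ-μ       = λ m n P → C.Equiv.trans C.identityʳ (C.Equiv.sym (C.Equiv.trans C.identityˡ
                      (C.Equiv.trans (Functor.identity C.act C.⟩∘⟨refl) C.identityˡ)))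
      ; φ-η       = λ P → C.identityʳ
      }
    ; φ-identity = λ m P → C.≋-refl
    }

proposition21 : ∀ {oM ℓM eM oB ℓB eB oC ℓC eC oE ℓE eE : Level}
    (M : MonoidalCategory oM ℓM eM)
    (B : Actegory M oB ℓB eB) (C : Actegory M oC ℓC eC) (E : Actegory M oE ℓE eE)
    (Γ : Functor (Actegory.category C) (Actegory.category B)) →
    LaxEquivariant C B Γ →
    (p : Functor (Actegory.category E) (Actegory.category B)) →
    StrictEquivariant E B p →
    IsOpfibration p →
    (∀ (m : MonoidalCategory.Obj M) → PreservesOpcartesian p (actOn E m)) →
    Σ[ a ∈ Action M (Pullback Γ p) ]
    StrictEquivariant (actegory (Pullback Γ p) a) C (pullbackProj Γ p)
proposition21 M B C E Γ Γ-lax p p-strict p-opf act-opcartesian = action , proj-strict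
  where open PullbackAction M B C E Γ Γ-lax p p-strict p-opf act-opcartesian
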